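{- Let $G_0,G_1\in\mathbb{Z}$ with $\gcd(G_0,G_1)=1$, let $(G_n)_{n\ge0}$ satisfy $G_n=G_{n-1}+G_{n-2}$ for $n\ge2$, and let $\mu = G_1^2 - G_0 G_1 - G_0^2$. For every even integer $k \geq 1$ (i.e. $k\ge 2$ even), $$\mathcal{G}^2_{G_0,G_1}(k) = \begin{cases} F_k, & \text{if $5$ does not divide $\mu$},\\ 5 F_k, & \text{if $5$ divides $\mu$},\end{cases}$$ where $F_k$ is the $k$-th Fibonacci number.
   Context: $\mathcal{G}^2_{G_0,G_1}(k)=\gcd\{\sum_{i=1}^k G_{n+i}^2 : n\ge 0\}$ (nonnegative gcd of this infinite set). $F_0=0$, $F_1=1$, $F_n=F_{n-1}+F_{n-2}$. -}

module Defs where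

open import Data.Fin.Base using (toℕ)
open import Data.Integer.Base as ℤ using (ℤ; +_)
open import Data.Integer.Divisibility using (_∣_)
import Data.Integer.Properties as ℤ
open import Data.Nat.Base as ℕ using (ℕ; suc)
import Data.Nat.Divisibility as ℕ
open import Data.Product.Base using (∃-syntax)
open import Level using (Level)
open import Relation.Binary.PropositionalEquality.Core using (_≡_)
open import Relation.Unary using (Pred; _∈_)

open import Algebra.Properties.Monoid.Sum ℤ.+-0-monoid using (sum-syntax)

private variable
  ℓ : Level

fib : ℕ → ℕ
fib 0             = 0
fib 1             = 1
fib (suc (suc n)) = fib (suc n) ℕ.+ fib n

FibonacciRecurrence : (ℕ → ℤ) → Set
FibonacciRecurrence G = ∀ n → G (2 ℕ.+ n) ≡ G (1 ℕ.+ n) ℤ.+ G n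

-- The gcd of a possibly infinite set of integers is given as a relation, since
-- it is not computable from an arbitrary set.  Taking d in ℕ fixes the sign.
record IsGCD (S : Pred ℤ ℓ) (d : ℕ) : Set ℓ where
  constructor isGCD
  field
    common   : ∀ {z} → z ∈ S → + d ∣ z
    greatest : ∀ c → (∀ {z} → z ∈ S → c ∣ z) → c ∣ + d

IsGCD-unique : ∀ {S : Pred ℤ ℓ} {d e} → IsGCD S d → IsGCD S e → d ≡ e
IsGCD-unique (isGCD d∣S S∣d) (isGCD e∣S S∣e) =
  ℕ.∣-antisym (S∣e (+ _) d∣S) (S∣d (+ _) e∣S)

-- G (n+1) ² + … + G (n+k) ².  An index i : Fin k starts at 0, hence the suc.
sumOfSquares : (ℕ → ℤ) → ℕ → ℕ → ℤ
sumOfSquares G k n = ∑[ i < k ] (G (n ℕ.+ suc (toℕ i)) ℤ.^ 2)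

SumsOfSquares : (ℕ → ℤ) → ℕ → Pred ℤ _
SumsOfSquares G k z = ∃[ n ] z ≡ sumOfSquares G k n

-- Read 𝒢² G k d as the equation 𝒢²_{G 0, G 1}(k) = d, meaningful as such by
-- IsGCD-unique; the recurrence determines G from G 0 and G 1.
𝒢² : (ℕ → ℤ) → ℕ → ℕ → Set
𝒢² G k d = IsGCD (SumsOfSquares G k) d

μ : (ℕ → ℤ) → ℤ
μ G = G 1 ℤ.^ 2 ℤ.- G 0 ℤ.* G 1 ℤ.- G 0 ℤ.^ 2

{-# OPTIONS --safe #-}
-- For k = 2m the sum of squares telescopes and factors as
--   G(n+1)² + … + G(n+k)² = F(k) · T(m+n),   T(j) = G(j)² + G(j+1)².
-- Since T(j) = 3T(j+1) − T(j+2), a common divisor c of all the sums divides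
-- F(k) T(0) and F(k) T(1).  With a = G(0) and b = G(1), the integer combinations
-- of T(0) and T(1) with coefficients linear in a, b include 5a³, 5a²b, 5ab² and 5b³,
-- whence c ∣ 5F(k) by coprimality; also μ ≡ 2T(1) − 3T(0) modulo 5, so that
-- c ∣ F(k) if 5 ∤ μ.  Conversely 4μ ≡ (2b − a)² and T(0) ≡ (a − 2b)(a + 2b)
-- modulo 5, and μ only changes sign when G is shifted, so that 5 ∣ μ makes
-- 5 divide every T(j).
module Submission where

open import Defs
open import Data.Fin.Base using (toℕ)
open import Data.Integer.Base as ℤ using (ℤ; +_; 1ℤ; ∣_∣; _+_; _-_; -_)
open import Data.Integer.Divisibility using (_∣_)
import Data.Integer.Divisibility.Signed as Signed
open import Data.Integer.GCD using (gcd)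
import Data.Integer.Properties as ℤ
open import Data.Integer.Tactic.RingSolver using (solve-∀)
open import Data.Nat.Base as ℕ using (ℕ; zero; suc; _*_; _≥_)
open import Data.Nat.Coprimality using (Coprime; coprime-factors; gcd≡1⇒coprime)
import Data.Nat.Divisibility as ℕ
open import Data.Nat.Primality using (Prime; prime?; prime⇒irreducible; euclidsLemma)
import Data.Nat.Properties as ℕ
open import Data.Product.Base using (_×_; _,_)
open import Data.Sum.Base using (inj₁; inj₂; reduce)
open import Function.Base using (_∘_)
open import Relation.Binary.PropositionalEquality
  using (_≡_; refl; sym; trans; cong; cong₂; subst; subst₂; module ≡-Reasoning)
open import Relation.Nullary.Decidable using (from-yes)
open import Relation.Nullary.Negation.Core using (¬_; contradiction)
open import Relation.Unary using (_∈_)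

open import Algebra.Properties.Monoid.Sum ℤ.+-0-monoid using (sum-cong-≗)

-- Fibonacci numbers and two quadratic forms

F : ℕ → ℤ
F n = + fib n

F-recurrence : FibonacciRecurrence F
F-recurrence _ = refl

-- The norm of b - aφ in ℤ[φ], with φ the golden ratio, a = G(j) and b = G(j+1); at j = 0 it is μ.
norm : (ℕ → ℤ) → ℕ → ℤ
norm G j = G (suc j) ℤ.* G (suc j) - G j ℤ.* G (suc j) - G j ℤ.* G j

T : (ℕ → ℤ) → ℕ → ℤ
T G j = G j ℤ.* G j + G (suc j) ℤ.* G (suc j)

-- Divisibility and coprime cancellation

∣-combination : ∀ {c x y} p q → c Signed.∣ x → c Signed.∣ y →
                c Signed.∣ p ℤ.* x + q ℤ.* y
∣-combination p q c∣x c∣y =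
  Signed.∣m∣n⇒∣m+n (Signed.∣n⇒∣m*n p c∣x) (Signed.∣n⇒∣m*n q c∣y)

-- By coprimality gcd(aw, bw) = |w|. This serves both for the pair G(0), G(1) and for the pair 5, μ.
coprime-factorsℤ : ∀ a b {c} w → Coprime ∣ a ∣ ∣ b ∣ →
                   c Signed.∣ a ℤ.* w → c Signed.∣ b ℤ.* w → c Signed.∣ w
coprime-factorsℤ a b {c} w coprime c∣aw c∣bw = Signed.∣ᵤ⇒∣
  (coprime-factors coprime (absolute a c∣aw , absolute b c∣bw))
  where
  absolute : ∀ x → c Signed.∣ x ℤ.* w → ∣ c ∣ ℕ.∣ ∣ x ∣ * ∣ w ∣
  absolute x = subst (∣ c ∣ ℕ.∣_) (ℤ.abs-* x w) ∘ Signed.∣⇒∣ᵤ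

prime∤⇒coprime : ∀ {p n} → Prime p → ¬ p ℕ.∣ n → Coprime p n
prime∤⇒coprime p-prime p∤n (d∣p , d∣n) with prime⇒irreducible p-prime d∣p
... | inj₁ d≡1  = d≡1
... | inj₂ refl = contradiction d∣n p∤n

5-prime : Prime 5
5-prime = from-yes (prime? 5)

5∣x²⇒5∣x : ∀ x → + 5 Signed.∣ x ℤ.* x → + 5 Signed.∣ x
5∣x²⇒5∣x x 5∣x² = Signed.∣ᵤ⇒∣ (reduce (euclidsLemma ∣ x ∣ ∣ x ∣ 5-prime
  (subst (5 ℕ.∣_) (ℤ.abs-* x x) (Signed.∣⇒∣ᵤ 5∣x²))))

coprime∧∣forms⇒∣5w : ∀ a b {c} w → Coprime ∣ a ∣ ∣ b ∣ →
  c Signed.∣ w ℤ.* (a ℤ.* a + b ℤ.* b) →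
  c Signed.∣ w ℤ.* (b ℤ.* b + (b + a) ℤ.* (b + a)) →
  c Signed.∣ + 5 ℤ.* w
coprime∧∣forms⇒∣5w a b {c} w coprime c∣wt₀ c∣wt₁ =
  -- Each `cancel` strips the outermost factor, so the tree starts from all eight words of length
  -- three in a and b.
  cancel 5w
    (cancel (a ℤ.* 5w) (cancel (a ℤ.* (a ℤ.* 5w)) c∣aaa c∣baa)
                       (cancel (b ℤ.* (a ℤ.* 5w)) c∣aba c∣bba))
    (cancel (b ℤ.* 5w) (cancel (a ℤ.* (b ℤ.* 5w)) c∣aab c∣bab)
                       (cancel (b ℤ.* (b ℤ.* 5w)) c∣abb c∣bbb))
  where
  5w = + 5 ℤ.* w

  cancel : ∀ x → c Signed.∣ a ℤ.* x → c Signed.∣ b ℤ.* x → c Signed.∣ x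
  cancel x = coprime-factorsℤ a b x coprime

  combine : ∀ p q {x} → p ℤ.* (w ℤ.* (a ℤ.* a + b ℤ.* b)) +
            q ℤ.* (w ℤ.* (b ℤ.* b + (b + a) ℤ.* (b + a))) ≡ x → c Signed.∣ x
  combine p q eq = subst (c Signed.∣_) eq (∣-combination p q c∣wt₀ c∣wt₁)

  -- The forms a² + b² and a² + 2ab + 2b² have resultant 5. The coefficients here and below solve
  -- the resulting 4 × 4 Sylvester system, one cubic monomial at a time.
  aaa : ∀ a b w → (+ 6 ℤ.* a + + 4 ℤ.* b) ℤ.* (w ℤ.* (a ℤ.* a + b ℤ.* b)) +
    (- a - + 2 ℤ.* b) ℤ.* (w ℤ.* (b ℤ.* b + (b + a) ℤ.* (b + a)))
    ≡ a ℤ.* (a ℤ.* (a ℤ.* (+ 5 ℤ.* w)))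
  aaa = solve-∀

  aab : ∀ a b w → (+ 2 ℤ.* b - + 2 ℤ.* a) ℤ.* (w ℤ.* (a ℤ.* a + b ℤ.* b)) +
    (+ 2 ℤ.* a - b) ℤ.* (w ℤ.* (b ℤ.* b + (b + a) ℤ.* (b + a)))
    ≡ a ℤ.* (a ℤ.* (b ℤ.* (+ 5 ℤ.* w)))
  aab = solve-∀

  abb : ∀ a b w → (- a - + 4 ℤ.* b) ℤ.* (w ℤ.* (a ℤ.* a + b ℤ.* b)) +
    (a + + 2 ℤ.* b) ℤ.* (w ℤ.* (b ℤ.* b + (b + a) ℤ.* (b + a)))
    ≡ a ℤ.* (b ℤ.* (b ℤ.* (+ 5 ℤ.* w)))
  abb = solve-∀

  bbb : ∀ a b w → (+ 3 ℤ.* b + + 2 ℤ.* a) ℤ.* (w ℤ.* (a ℤ.* a + b ℤ.* b)) +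
    (b - + 2 ℤ.* a) ℤ.* (w ℤ.* (b ℤ.* b + (b + a) ℤ.* (b + a)))
    ≡ b ℤ.* (b ℤ.* (b ℤ.* (+ 5 ℤ.* w)))
  bbb = solve-∀

  swap : ∀ x y z → x ℤ.* (y ℤ.* z) ≡ y ℤ.* (x ℤ.* z)
  swap = solve-∀

  c∣aaa = combine (+ 6 ℤ.* a + + 4 ℤ.* b) (- a - + 2 ℤ.* b) (aaa a b w)
  c∣aab = combine (+ 2 ℤ.* b - + 2 ℤ.* a) (+ 2 ℤ.* a - b) (aab a b w)
  c∣abb = combine (- a - + 4 ℤ.* b) (a + + 2 ℤ.* b) (abb a b w)
  c∣bbb = combine (+ 3 ℤ.* b + + 2 ℤ.* a) (b - + 2 ℤ.* a) (bbb a b w)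
  c∣aba = subst (c Signed.∣_) (cong (a ℤ.*_) (swap a b 5w)) c∣aab
  c∣baa = subst (c Signed.∣_) (swap a b (a ℤ.* 5w)) c∣aba
  c∣bab = subst (c Signed.∣_) (swap a b (b ℤ.* 5w)) c∣abb
  c∣bba = subst (c Signed.∣_) (cong (b ℤ.*_) (swap a b 5w)) c∣bab

-- Identities for Fibonacci recurrences

module _ (G : ℕ → ℤ) (rec : FibonacciRecurrence G) where

  -- A shift multiplies b - aφ by 1 - φ, a unit of norm -1.
  norm-suc : ∀ j → norm G (suc j) ≡ - norm G j
  norm-suc j rewrite rec j = identity (G j) (G (suc j))
    where
    identity : ∀ a b → (b + a) ℤ.* (b + a) - b ℤ.* (b + a) - b ℤ.* b
                       ≡ - (b ℤ.* b - a ℤ.* b - a ℤ.* a)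
    identity = solve-∀

  -- The alternating parts of two consecutive squares cancel in T, leaving powers of φ² and φ⁻²,
  -- whose sum is 3 and product 1. Solved for the smallest index, the recurrence carries
  -- divisibility downwards.
  T-descent : ∀ j → T G j ≡ + 3 ℤ.* T G (1 ℕ.+ j) + - 1ℤ ℤ.* T G (2 ℕ.+ j)
  T-descent j rewrite rec (suc j) | rec j = identity (G j) (G (suc j))
    where
    identity : ∀ a b → a ℤ.* a + b ℤ.* b ≡
      + 3 ℤ.* (b ℤ.* b + (b + a) ℤ.* (b + a)) +
      - 1ℤ ℤ.* ((b + a) ℤ.* (b + a) + (b + a + b) ℤ.* (b + a + b))
    identity = solve-∀

  -- The coefficient F(m-1) is written F(m+1) - F(m), which also makes sense at m = 0.
  addition : ∀ m n → G (m ℕ.+ n) ≡ F m ℤ.* G (suc n) + (F (suc m) - F m) ℤ.* G n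
  addition zero n = identity (G n) (G (suc n))
    where
    identity : ∀ a b → a ≡ + 0 ℤ.* b + (+ 1 - + 0) ℤ.* a
    identity = solve-∀
  addition (suc zero) n = identity (G n) (G (suc n))
    where
    identity : ∀ a b → b ≡ + 1 ℤ.* b + (+ 1 - + 1) ℤ.* a
    identity = solve-∀
  addition (suc (suc m)) n = trans (rec (m ℕ.+ n))
    (trans (cong₂ _+_ (addition (suc m) n) (addition m n))
           (identity (F m) (F (suc m)) (G n) (G (suc n))))
    where
    identity : ∀ u v a b →
      v ℤ.* b + (v + u - v) ℤ.* a + (u ℤ.* b + (v - u) ℤ.* a)
      ≡ (v + u) ℤ.* b + (v + u + v - (v + u)) ℤ.* a
    identity = solve-∀

  -- Each square is G(i)² = G(i)G(i+1) - G(i-1)G(i).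
  sumOfSquares-telescope : ∀ k n → sumOfSquares G k n ≡
    G (k ℕ.+ n) ℤ.* G (suc (k ℕ.+ n)) - G n ℤ.* G (suc n)
  sumOfSquares-telescope zero n = sym (ℤ.+-inverseʳ (G n ℤ.* G (suc n)))
  sumOfSquares-telescope (suc k) n = begin
    G (n ℕ.+ 1) ℤ.^ 2 + _
      ≡⟨ cong₂ (λ i s → G i ℤ.^ 2 + s) (ℕ.+-comm n 1)
           (sum-cong-≗ {k} (λ i → cong (λ j → G j ℤ.^ 2) (ℕ.+-suc n (suc (toℕ i))))) ⟩
    G (suc n) ℤ.^ 2 + sumOfSquares G k (suc n)
      ≡⟨ cong (λ s → G (suc n) ℤ.^ 2 + s) (sumOfSquares-telescope k (suc n)) ⟩
    G (suc n) ℤ.^ 2 + (G (k ℕ.+ suc n) ℤ.* G (suc (k ℕ.+ suc n))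
                       - G (suc n) ℤ.* G (2 ℕ.+ n))
      ≡⟨ cong₂ (λ i x → G (suc n) ℤ.^ 2 + (G i ℤ.* G (suc i) - G (suc n) ℤ.* x))
           (ℕ.+-suc k n) (rec n) ⟩
    G (suc n) ℤ.^ 2 + (G (suc (k ℕ.+ n)) ℤ.* G (2 ℕ.+ (k ℕ.+ n))
                       - G (suc n) ℤ.* (G (suc n) + G n))
      ≡⟨ identity (G n) (G (suc n)) (G (suc (k ℕ.+ n)) ℤ.* G (2 ℕ.+ (k ℕ.+ n))) ⟩
    G (suc (k ℕ.+ n)) ℤ.* G (2 ℕ.+ (k ℕ.+ n)) - G n ℤ.* G (suc n) ∎
    where
    open ≡-Reasoning
    identity : ∀ a b x → b ℤ.* (b ℤ.* 1ℤ) + (x - b ℤ.* (b + a)) ≡ x - a ℤ.* b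
    identity = solve-∀

  -- The sums of length 2m only give T(j) with j ≥ m; `T-descent`, applied m times, reaches T(0) and
  -- T(1).
  T-antitone-∣ : ∀ {c} w m → (∀ n → c Signed.∣ w ℤ.* T G (m ℕ.+ n)) →
                 ∀ n → c Signed.∣ w ℤ.* T G n
  T-antitone-∣ w zero    c∣wT = c∣wT
  T-antitone-∣ {c} w (suc m) c∣wT = T-antitone-∣ w m λ n →
    subst (c Signed.∣_)
      (trans (identity w (T G (1 ℕ.+ (m ℕ.+ n))) (T G (2 ℕ.+ (m ℕ.+ n))))
             (cong (w ℤ.*_) (sym (T-descent (m ℕ.+ n)))))
      (∣-combination (+ 3) (- 1ℤ) (c∣wT n)
        (subst (λ j → c Signed.∣ w ℤ.* T G (suc j)) (ℕ.+-suc m n) (c∣wT (suc n))))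
    where
    identity : ∀ w x y → + 3 ℤ.* (w ℤ.* x) + - 1ℤ ℤ.* (w ℤ.* y)
                         ≡ w ℤ.* (+ 3 ℤ.* x + - 1ℤ ℤ.* y)
    identity = solve-∀

  5∣norm : + 5 Signed.∣ norm G 0 → ∀ j → + 5 Signed.∣ norm G j
  5∣norm 5∣μ zero    = 5∣μ
  5∣norm 5∣μ (suc j) =
    subst (+ 5 Signed.∣_) (sym (norm-suc j)) (Signed.∣m⇒∣-m (5∣norm 5∣μ j))

-- Doubling formulas and sums of even length

-- Cassini's identity, squared to remove the sign (-1)^m.
norm-F² : ∀ m → norm F m ℤ.* norm F m ≡ 1ℤ
norm-F² zero = refl
norm-F² (suc m) =
  trans (cong (λ x → x ℤ.* x) (norm-suc F F-recurrence m))
        (trans (identity (norm F m)) (norm-F² m))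
  where
  identity : ∀ x → - x ℤ.* - x ≡ x ℤ.* x
  identity = solve-∀

F-double : ∀ m → F (m ℕ.+ m) ≡ F m ℤ.* F (suc m) + (F (suc m) - F m) ℤ.* F m
F-double m = addition F F-recurrence m m

F-suc-double : ∀ m → F (suc (m ℕ.+ m)) ≡ F m ℤ.* F m + F (suc m) ℤ.* F (suc m)
F-suc-double m = trans (cong F (sym (ℕ.+-suc m m)))
  (trans (addition F F-recurrence m (suc m)) (identity (F m) (F (suc m))))
  where
  identity : ∀ u v → u ℤ.* (v + u) + (v - u) ℤ.* v ≡ u ℤ.* u + v ℤ.* v
  identity = solve-∀

-- The addition and doubling formulas turn the telescoped sum into a polynomial in F(m), F(m+1),
-- G(n) and G(n+1).
sumOfSquares-even : ∀ G → FibonacciRecurrence G → ∀ m n →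
  sumOfSquares G (m ℕ.+ m) n ≡ F (m ℕ.+ m) ℤ.* T G (m ℕ.+ n)
sumOfSquares-even G rec m n = begin
  sumOfSquares G (m ℕ.+ m) n
    ≡⟨ sumOfSquares-telescope G rec (m ℕ.+ m) n ⟩
  G (m ℕ.+ m ℕ.+ n) ℤ.* G (suc (m ℕ.+ m ℕ.+ n)) - a ℤ.* b
    ≡⟨ cong₂ (λ x y → x ℤ.* y - a ℤ.* b)
         (addition G rec (m ℕ.+ m) n) (addition G rec (suc (m ℕ.+ m)) n) ⟩
  (f ℤ.* b + (g - f) ℤ.* a) ℤ.* (g ℤ.* b + (g + f - g) ℤ.* a) - a ℤ.* b
    ≡⟨ cong (λ x → (f ℤ.* b + (g - f) ℤ.* a) ℤ.* (g ℤ.* b + (g + f - g) ℤ.* a) - x)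
         (ℤ.*-identityˡ (a ℤ.* b)) ⟨
  difference f g 1ℤ
    ≡⟨ cong₂ (λ x y → difference x y 1ℤ) (F-double m) (F-suc-double m) ⟩
  difference f′ g′ 1ℤ
    -- Inserting norm² = 1 makes both sides homogeneous in u and v.
    ≡⟨ cong (difference f′ g′) (norm-F² m) ⟨
  difference f′ g′ (norm F m ℤ.* norm F m)
    ≡⟨ identity u v a b ⟩
  f′ ℤ.* ((u ℤ.* b + (v - u) ℤ.* a) ℤ.* (u ℤ.* b + (v - u) ℤ.* a)
          + (v ℤ.* b + (v + u - v) ℤ.* a) ℤ.* (v ℤ.* b + (v + u - v) ℤ.* a))
    ≡⟨ cong₂ ℤ._*_ (F-double m) (cong₂ (λ x y → x ℤ.* x + y ℤ.* y)
         (addition G rec m n) (addition G rec (suc m) n)) ⟨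
  F (m ℕ.+ m) ℤ.* T G (m ℕ.+ n) ∎
  where
  open ≡-Reasoning
  a = G n
  b = G (suc n)
  u = F m
  v = F (suc m)
  f = F (m ℕ.+ m)
  g = F (suc (m ℕ.+ m))
  f′ = u ℤ.* v + (v - u) ℤ.* u
  g′ = u ℤ.* u + v ℤ.* v

  difference : ℤ → ℤ → ℤ → ℤ
  difference f g e =
    (f ℤ.* b + (g - f) ℤ.* a) ℤ.* (g ℤ.* b + (g + f - g) ℤ.* a) - e ℤ.* (a ℤ.* b)

  identity : ∀ u v a b →
    ((u ℤ.* v + (v - u) ℤ.* u) ℤ.* b
      + (u ℤ.* u + v ℤ.* v - (u ℤ.* v + (v - u) ℤ.* u)) ℤ.* a)
    ℤ.* ((u ℤ.* u + v ℤ.* v) ℤ.* b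
      + (u ℤ.* u + v ℤ.* v + (u ℤ.* v + (v - u) ℤ.* u) - (u ℤ.* u + v ℤ.* v)) ℤ.* a)
    - (v ℤ.* v - u ℤ.* v - u ℤ.* u) ℤ.* (v ℤ.* v - u ℤ.* v - u ℤ.* u) ℤ.* (a ℤ.* b)
    ≡ (u ℤ.* v + (v - u) ℤ.* u) ℤ.*
      ((u ℤ.* b + (v - u) ℤ.* a) ℤ.* (u ℤ.* b + (v - u) ℤ.* a)
       + (v ℤ.* b + (v + u - v) ℤ.* a) ℤ.* (v ℤ.* b + (v + u - v) ℤ.* a))
  identity = solve-∀

-- The norm form modulo 5

5∣norm⇒5∣T : ∀ G j → + 5 Signed.∣ norm G j → + 5 Signed.∣ T G j
5∣norm⇒5∣T G j 5∣norm = subst (+ 5 Signed.∣_) (reduction a b)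
  (∣-combination (b ℤ.* b) (- + 2 ℤ.* b - a) Signed.∣-refl
    (5∣x²⇒5∣x (+ 2 ℤ.* b - a) (subst (+ 5 Signed.∣_) (square a b)
      (∣-combination (+ 4) (a ℤ.* a) 5∣norm Signed.∣-refl))))
  where
  a = G j
  b = G (suc j)

  -- Completing the square: the norm form has discriminant 5, so four times it is a square modulo 5.
  square : ∀ a b → + 4 ℤ.* (b ℤ.* b - a ℤ.* b - a ℤ.* a) + a ℤ.* a ℤ.* + 5
                   ≡ (+ 2 ℤ.* b - a) ℤ.* (+ 2 ℤ.* b - a)
  square = solve-∀

  reduction : ∀ a b → b ℤ.* b ℤ.* + 5 + (- + 2 ℤ.* b - a) ℤ.* (+ 2 ℤ.* b - a)
                      ≡ a ℤ.* a + b ℤ.* b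
  reduction = solve-∀

μ≡norm : ∀ G → μ G ≡ norm G 0
μ≡norm G = identity (G 0) (G 1)
  where
  identity : ∀ a b → b ℤ.* (b ℤ.* 1ℤ) - a ℤ.* b - a ℤ.* (a ℤ.* 1ℤ)
                     ≡ b ℤ.* b - a ℤ.* b - a ℤ.* a
  identity = solve-∀

-- Common divisors of the sums

module _ (G : ℕ → ℤ) (rec : FibonacciRecurrence G) (m : ℕ) where

  private
    k = m ℕ.+ m
    w = F k

  common-∣ : ∀ {z} → z ∈ SumsOfSquares G k → w Signed.∣ z
  common-∣ (n , refl) = subst (w Signed.∣_) (sym (sumOfSquares-even G rec m n))
    (Signed.∣m⇒∣m*n (T G (m ℕ.+ n)) Signed.∣-refl)

  5∣μ⇒common-∣ : + 5 ∣ μ G → ∀ {z} → z ∈ SumsOfSquares G k → + 5 ℤ.* w Signed.∣ z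
  5∣μ⇒common-∣ 5∣μ (n , refl) = subst₂ Signed._∣_ (ℤ.*-comm w (+ 5))
    (sym (sumOfSquares-even G rec m n))
    (Signed.*-monoʳ-∣ w (5∣norm⇒5∣T G (m ℕ.+ n) (5∣norm G rec
      (subst (+ 5 Signed.∣_) (μ≡norm G) (Signed.∣ᵤ⇒∣ 5∣μ)) (m ℕ.+ n))))

  module _ {c : ℤ} (c∣S : ∀ {z} → z ∈ SumsOfSquares G k → c ∣ z)
           (coprime : Coprime ∣ G 0 ∣ ∣ G 1 ∣) where

    c∣wT : ∀ n → c Signed.∣ w ℤ.* T G n
    c∣wT = T-antitone-∣ G rec w m λ n → subst (c Signed.∣_) (sumOfSquares-even G rec m n)
      (Signed.∣ᵤ⇒∣ (c∣S (n , refl)))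

    c∣wT₁ : c Signed.∣ w ℤ.* (G 1 ℤ.* G 1 + (G 1 + G 0) ℤ.* (G 1 + G 0))
    c∣wT₁ = subst (λ x → c Signed.∣ w ℤ.* (G 1 ℤ.* G 1 + x ℤ.* x)) (rec 0) (c∣wT 1)

    c∣5w : c Signed.∣ + 5 ℤ.* w
    c∣5w = coprime∧∣forms⇒∣5w (G 0) (G 1) w coprime (c∣wT 0) c∣wT₁

    -- Exactly, 2T(1) - 3T(0) = μ + 5ab with a = G(0), b = G(1); `c∣5w` absorbs the excess.
    c∣μw : c Signed.∣ μ G ℤ.* w
    c∣μw = subst (c Signed.∣_)
      (trans (identity (G 0) (G 1) w) (cong (ℤ._* w) (sym (μ≡norm G))))
      (Signed.∣m∣n⇒∣m+n (∣-combination (+ 2) (- + 3) c∣wT₁ (c∣wT 0))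
                        (Signed.∣n⇒∣m*n (- (G 0 ℤ.* G 1)) c∣5w))
      where
      identity : ∀ a b w → + 2 ℤ.* (w ℤ.* (b ℤ.* b + (b + a) ℤ.* (b + a)))
        + - + 3 ℤ.* (w ℤ.* (a ℤ.* a + b ℤ.* b)) + - (a ℤ.* b) ℤ.* (+ 5 ℤ.* w)
        ≡ (b ℤ.* b - a ℤ.* b - a ℤ.* a) ℤ.* w
      identity = solve-∀

    5∤μ⇒c∣w : ¬ (+ 5 ∣ μ G) → c Signed.∣ w
    5∤μ⇒c∣w 5∤μ = coprime-factorsℤ (+ 5) (μ G) w (prime∤⇒coprime 5-prime 5∤μ) c∣5w c∣μw

theorem4p7 : (G : ℕ → ℤ) → FibonacciRecurrence G → gcd (G 0) (G 1) ≡ 1ℤ →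
    (k : ℕ) → k ≥ 1 → 2 ℕ.∣ k →
    (¬ (+ 5 ∣ μ G) → 𝒢² G k (fib k)) × (+ 5 ∣ μ G → 𝒢² G k (5 * fib k))
theorem4p7 G rec gcd≡1 k _ (ℕ.divides m k≡m*2)
  -- Evenness is used in the form k = m + m, which suits the doubling formulas.
  rewrite trans k≡m*2 (trans (ℕ.*-comm m 2) (cong (m ℕ.+_) (ℕ.+-identityʳ m))) =
  (λ 5∤μ → isGCD
    (λ z∈S → Signed.∣⇒∣ᵤ (common-∣ G rec m z∈S))
    (λ c c∣S → Signed.∣⇒∣ᵤ (5∤μ⇒c∣w G rec m {c} c∣S coprime 5∤μ))) ,
  (λ 5∣μ → isGCD
    (λ {z} z∈S → Signed.∣⇒∣ᵤ (subst (Signed._∣ z) (sym 5F≡) (5∣μ⇒common-∣ G rec m 5∣μ z∈S)))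
    (λ c c∣S → Signed.∣⇒∣ᵤ (subst (c Signed.∣_) (sym 5F≡) (c∣5w G rec m {c} c∣S coprime))))
  where
  coprime = gcd≡1⇒coprime (ℤ.+-injective gcd≡1)

  5F≡ : + (5 * fib (m ℕ.+ m)) ≡ + 5 ℤ.* F (m ℕ.+ m)
  5F≡ = ℤ.pos-* 5 (fib (m ℕ.+ m))
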